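{- Let $F$ and $G$ be 1-sorted species with $F$ strictly finite. Then there is a natural isomorphism between the functors $F(G[\,\cdot\,])$ (the analytic functor of $F$ composed with the functor $G$) and $F\boxtimes G$ (the inner plethysm of the species $F$ and $G$).
   Context: $\mathbb{B}$ is the category of finite sets and bijections; a 1-sorted species is a functor $\mathbb{B}\to\mathbb{B}$, a 2-sorted species is a functor $\mathbb{B}^2\to\mathbb{B}$. $[n]=\{1,\dots,n\}$, $F[n]=F[[n]]$; $F$ is strictly finite if $F[n]=\emptyset$ for all large $n$. The analytic functor of $F$ is, for a set $A$, $F(A)=\sum_{n\ge0}(F[n]\times A^n)/\mathfrak{S}_n$ (disjoint union of orbit sets), where $A^n$ is the set of functions $[n]\to A$, $\sigma\cdot(t,f)=(F[\sigma](t),f\circ\sigma^{ -1})$; a function $g:A\to B$ sends the orbit of $(t,f)$ to the orbit of $(t,g\circ f)$. Since $F$ is strictly finite, $F(A)$ is finite for finite $A$, so $A\mapsto F(G[A])$ is a species. For a 2-sorted species $K(X,Y)$ and a 1-sorted species $F(X)$, regarded as 2-sorted with no points of sort $Y$, the Cartesian product in $X$ is $(F\times_X K)[U,V]=F[U]\times K[U,V]$, and the scalar product in $X$, $\langle F,K\rangle_X=(F\times_X K)|_{X=1}$, is the species of structures with the $X$-points unlabeled: $\langle F,K\rangle_X[V]=\sum_{n\ge0}(F[n]\times K[[n],V])/\mathfrak{S}_n$. For a 1-sorted species $G$, $\Phi(G)[U,V]$ is the set of all functions from $U$ to $G[V]$, with transport $f\mapsto G[\sigma]\circ f\circ\beta^{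 -1}$ along bijections $(\beta,\sigma)$. The inner plethysm is $(F\boxtimes G)(Y)=\langle F(X),\Phi(G)(X,Y)\rangle_X$. -}

module Defs where

open import Level using (Level; 0ℓ; _⊔_) renaming (suc to lsuc)
open import Data.Empty using (⊥-elim)
open import Data.Fin.Base using (Fin; zero; suc; finToFun; funToFin; combine)
open import Data.Fin.Properties
  using (any?; all?; *↔×; finToFun-funToFin; funToFin-finToFin)
  renaming (_≟_ to _≟ᶠ_)
open import Data.List.Base using (List; []; _∷_; lookup; length; map; concatMap; upTo; allFin; deduplicate)
open import Data.List.Membership.Propositional.Properties using (∈-upTo⁺; ∈-allFin)
import Data.List.Membership.Setoid.Properties as Membership
open import Data.List.Relation.Unary.All using (All; []; _∷_)
open import Data.List.Relation.Unary.AllPairs using ([]; _∷_)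
import Data.List.Relation.Unary.Any as Any
open import Data.List.Relation.Unary.Any.Properties using (lookup-index)
open import Data.List.Relation.Unary.Enumerates.Setoid using (IsEnumeration)
import Data.List.Relation.Unary.Enumerates.Setoid.Properties as EnumerationP
import Data.List.Relation.Unary.Unique.Setoid as Unique
import Data.List.Relation.Unary.Unique.DecSetoid.Properties as UniqueP
open import Data.Nat.Base using (ℕ; zero; suc; _≤_; _^_; _*_)
open import Data.Nat.Properties using (_≟_; _<?_; ≮⇒≥)
open import Data.Product.Base using (Σ; ∃; ∃-syntax; _×_; _,_; proj₁; proj₂)
open import Data.Product.Function.NonDependent.Setoid using (_×-inverse_; _×-function_)
open import Data.Product.Relation.Binary.Pointwise.NonDependent using (_×ₛ_; Pointwise-≡↔≡)
open import Function.Bundles using (Func; Inverse; mk↔ₛ′)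
import Function.Construct.Composition as Compose
import Function.Construct.Identity as Identity
import Function.Construct.Symmetry as Symmetry
open import Function.Definitions using (StrictlyInverseˡ; StrictlyInverseʳ)
open import Function.Properties.Inverse using (toFunction)
import Function.Relation.Binary.Setoid.Equality as FuncEq
open import Relation.Binary.Bundles using (Setoid; DecSetoid)
open import Relation.Binary.Core using (Rel)
open import Relation.Binary.Definitions using (Decidable)
open import Relation.Binary.Structures using (IsEquivalence)
open import Relation.Binary.PropositionalEquality as ≡ using (_≡_; refl)
open import Relation.Nullary using (¬_; Dec; yes; no)
open import Relation.Nullary.Decidable using (map′; _×-dec_)

open Setoid using (Carrier)

-- As usual without quotients, hom-sets carry an explicit equivalence relation.
record Category (o ℓ e : Level) : Set (lsuc (o ⊔ ℓ ⊔ e)) where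
  infix  4 _≈_ _⇒_
  infixr 9 _∘_
  field
    Obj : Set o
    _⇒_ : Obj → Obj → Set ℓ
    _≈_ : ∀ {A B} → Rel (A ⇒ B) e
    id  : ∀ {A} → A ⇒ A
    _∘_ : ∀ {A B C} → B ⇒ C → A ⇒ B → A ⇒ C
    assoc     : ∀ {A B C D} {f : A ⇒ B} {g : B ⇒ C} {h : C ⇒ D} →
                (h ∘ g) ∘ f ≈ h ∘ (g ∘ f)
    identityˡ : ∀ {A B} {f : A ⇒ B} → id ∘ f ≈ f
    identityʳ : ∀ {A B} {f : A ⇒ B} → f ∘ id ≈ f
    equiv     : ∀ {A B} → IsEquivalence (_≈_ {A} {B})
    ∘-resp-≈  : ∀ {A B C} {f h : B ⇒ C} {g i : A ⇒ B} →
                f ≈ h → g ≈ i → f ∘ g ≈ h ∘ i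

private
  variable
    o ℓ e o′ ℓ′ e′ o″ ℓ″ e″ : Level

record Functor (C : Category o ℓ e) (D : Category o′ ℓ′ e′) :
               Set (o ⊔ ℓ ⊔ e ⊔ o′ ⊔ ℓ′ ⊔ e′) where
  private
    module C = Category C
    module D = Category D
  field
    F₀ : C.Obj → D.Obj
    F₁ : ∀ {A B} → A C.⇒ B → F₀ A D.⇒ F₀ B
    identity     : ∀ {A} → F₁ (C.id {A}) D.≈ D.id
    homomorphism : ∀ {A B C} {f : A C.⇒ B} {g : B C.⇒ C} →
                   F₁ (g C.∘ f) D.≈ F₁ g D.∘ F₁ f
    F-resp-≈     : ∀ {A B} {f g : A C.⇒ B} → f C.≈ g → F₁ f D.≈ F₁ g

infixr 9 _∘F_
_∘F_ : {C : Category o ℓ e} {D : Category o′ ℓ′ e′} {E : Category o″ ℓ″ e″} →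
       Functor D E → Functor C D → Functor C E
_∘F_ {E = E} G F = record
  { F₀ = λ A → G.F₀ (F.F₀ A)
  ; F₁ = λ f → G.F₁ (F.F₁ f)
  ; identity = E.trans (G.F-resp-≈ F.identity) G.identity
  ; homomorphism = E.trans (G.F-resp-≈ F.homomorphism) G.homomorphism
  ; F-resp-≈ = λ p → G.F-resp-≈ (F.F-resp-≈ p)
  }
  where
    module F = Functor F
    module G = Functor G
    module E {A B} = IsEquivalence (Category.equiv E {A} {B})

record NaturalTransformation {C : Category o ℓ e} {D : Category o′ ℓ′ e′}
                             (F G : Functor C D) :
                             Set (o ⊔ ℓ ⊔ e ⊔ o′ ⊔ ℓ′ ⊔ e′) where
  private
    module C = Category C
    module D = Category D
    module F = Functor F
    module G = Functor G
  field
    η       : ∀ X → F.F₀ X D.⇒ G.F₀ X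
    commute : ∀ {X Y} (f : X C.⇒ Y) → η Y D.∘ F.F₁ f D.≈ G.F₁ f D.∘ η X

record NaturalIsomorphism {C : Category o ℓ e} {D : Category o′ ℓ′ e′}
                          (F G : Functor C D) :
                          Set (o ⊔ ℓ ⊔ e ⊔ o′ ⊔ ℓ′ ⊔ e′) where
  private
    module D = Category D
  field
    F⇒G : NaturalTransformation F G
    F⇐G : NaturalTransformation G F
  module ⇒ = NaturalTransformation F⇒G
  module ⇐ = NaturalTransformation F⇐G
  field
    isoˡ : ∀ X → ⇐.η X D.∘ ⇒.η X D.≈ D.id
    isoʳ : ∀ X → ⇒.η X D.∘ ⇐.η X D.≈ D.id

infixr 2 _×C_
_×C_ : Category o ℓ e → Category o′ ℓ′ e′ → Category (o ⊔ o′) (ℓ ⊔ ℓ′) (e ⊔ e′)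
C ×C D = record
  { Obj = C.Obj × D.Obj
  ; _⇒_ = λ (A , B) (A′ , B′) → (A C.⇒ A′) × (B D.⇒ B′)
  ; _≈_ = λ (f , g) (f′ , g′) → (f C.≈ f′) × (g D.≈ g′)
  ; id  = C.id , D.id
  ; _∘_ = λ (f , g) (f′ , g′) → (f C.∘ f′) , (g D.∘ g′)
  ; assoc     = C.assoc , D.assoc
  ; identityˡ = C.identityˡ , D.identityˡ
  ; identityʳ = C.identityʳ , D.identityʳ
  ; equiv     = record
    { refl  = C.equiv.refl , D.equiv.refl
    ; sym   = λ (p , q) → C.equiv.sym p , D.equiv.sym q
    ; trans = λ (p , q) (p′ , q′) → C.equiv.trans p p′ , D.equiv.trans q q′
    }
  ; ∘-resp-≈  = λ (p , q) (p′ , q′) → C.∘-resp-≈ p p′ , D.∘-resp-≈ q q′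
  }
  where
    module C where
      open Category C public
      module equiv {A B} = IsEquivalence (Category.equiv C {A} {B})
    module D where
      open Category D public
      module equiv {A B} = IsEquivalence (Category.equiv D {A} {B})

-- Sets are setoids, so that the orbit sets below are again sets.
Sets : Category (lsuc 0ℓ) 0ℓ 0ℓ
Sets = record
  { Obj = Setoid 0ℓ 0ℓ
  ; _⇒_ = Func
  ; _≈_ = λ {A} {B} → FuncEq._≈_ A B
  ; id  = Identity.function _
  ; _∘_ = λ g f → Compose.function f g
  ; assoc     = λ {_} {_} {_} {D} _ → Setoid.refl D
  ; identityˡ = λ {_} {B} _ → Setoid.refl B
  ; identityʳ = λ {_} {B} _ → Setoid.refl B
  ; equiv     = λ {A} {B} → FuncEq.isEquivalence A B
  ; ∘-resp-≈  = λ {_} {_} {C} {h = h} {g} p q x →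
                Setoid.trans C (p (Func.to g x)) (Func.cong h (q x))
  }

module Sets = Category Sets

IsFinite : Setoid 0ℓ 0ℓ → Set
IsFinite S = ∃[ n ] Inverse S (≡.setoid (Fin n))

record FinSet : Set₁ where
  constructor _,_
  field
    set      : Setoid 0ℓ 0ℓ
    isFinite : IsFinite set

open FinSet public

-- A record, so that U and V can be inferred from a bijection.  Bijections ignore
-- the enumerations witnessing finiteness.
record Bij (U V : FinSet) : Set where
  constructor bij
  field
    iso : Inverse (set U) (set V)
  open Inverse iso public

  func : Func (set U) (set V)
  func = toFunction iso

infix 10 _⁻¹
_⁻¹ : ∀ {U V} → Bij U V → Bij V U
bij σ ⁻¹ = bij (Symmetry.inverse σ)

𝔹 : Category (lsuc 0ℓ) 0ℓ 0ℓ
𝔹 = record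
  { Obj = FinSet
  ; _⇒_ = Bij
  ; _≈_ = λ σ τ → Bij.func σ Sets.≈ Bij.func τ
  ; id  = bij (Identity.inverse _)
  ; _∘_ = λ (bij τ) (bij σ) → bij (Compose.inverse σ τ)
  ; assoc     = λ {_} {_} {_} {D} _ → Setoid.refl (set D)
  ; identityˡ = λ {_} {B} _ → Setoid.refl (set B)
  ; identityʳ = λ {_} {B} _ → Setoid.refl (set B)
  ; equiv     = λ {_} {V} → record
    { refl  = λ _ → Setoid.refl (set V)
    ; sym   = λ p x → Setoid.sym (set V) (p x)
    ; trans = λ p q x → Setoid.trans (set V) (p x) (q x)
    }
  ; ∘-resp-≈  = λ {_} {_} {C} {h = h} {g} p q x →
                Setoid.trans (set C) (p (Bij.to g x)) (Bij.to-cong h (q x))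
  }

module 𝔹 = Category 𝔹

⁻¹-cong : ∀ {U V} {σ τ : Bij U V} → σ 𝔹.≈ τ → σ ⁻¹ 𝔹.≈ τ ⁻¹
⁻¹-cong {U} {V} {σ} {τ} p y =
  Bij.inverseʳ σ (trans (sym (Bij.strictlyInverseˡ τ y)) (sym (p (Bij.from τ y))))
  where open Setoid (set V) using (sym; trans)

⁻¹-inverseˡ : ∀ {U V} (σ : Bij U V) → σ ⁻¹ 𝔹.∘ σ 𝔹.≈ 𝔹.id
⁻¹-inverseˡ σ = Bij.strictlyInverseʳ σ

⟦_⟧ : ℕ → FinSet
⟦ n ⟧ = ≡.setoid (Fin n) , (n , Identity.inverse _)

forget : Functor 𝔹 Sets
forget = record
  { F₀ = set
  ; F₁ = Bij.func
  ; identity     = λ {A} _ → Setoid.refl (set A)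
  ; homomorphism = λ {_} {_} {C} _ → Setoid.refl (set C)
  ; F-resp-≈     = λ p → p
  }

-- A set-valued functor on 𝔹 sends bijections to bijections, so it is a
-- functor 𝔹 → 𝔹 as soon as its values are finite.
corestrict : (T : Functor 𝔹 Sets) → (∀ V → IsFinite (Functor.F₀ T V)) → Functor 𝔹 𝔹
corestrict T fin = record
  { F₀ = λ V → T.F₀ V , fin V
  ; F₁ = λ σ → bij (record
    { to        = to (T.F₁ σ)
    ; from      = to (T.F₁ (σ ⁻¹))
    ; to-cong   = cong (T.F₁ σ)
    ; from-cong = cong (T.F₁ (σ ⁻¹))
    ; inverse   =
        (λ {x} p → Setoid.trans (T.F₀ _) (cong (T.F₁ σ) p) (cancel (σ ⁻¹) x))
      , (λ {x} p → Setoid.trans (T.F₀ _) (cong (T.F₁ (σ ⁻¹)) p) (cancel σ x))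
    })
  ; identity     = T.identity
  ; homomorphism = T.homomorphism
  ; F-resp-≈     = T.F-resp-≈
  }
  where
    module T = Functor T
    open Func using (to; cong)

    cancel : ∀ {U V} (σ : Bij U V) x →
             Setoid._≈_ (T.F₀ U) (to (T.F₁ (σ ⁻¹)) (to (T.F₁ σ) x)) x
    cancel {U} σ x = begin
      to (T.F₁ (σ ⁻¹)) (to (T.F₁ σ) x) ≈⟨ T.homomorphism x ⟨
      to (T.F₁ (σ ⁻¹ 𝔹.∘ σ)) x         ≈⟨ T.F-resp-≈ (⁻¹-inverseˡ σ) x ⟩
      to (T.F₁ 𝔹.id) x                 ≈⟨ T.identity x ⟩
      x                                ∎
      where open import Relation.Binary.Reasoning.Setoid (T.F₀ U)

module _ {S T : Setoid 0ℓ 0ℓ} where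

  ×-isFinite : IsFinite S → IsFinite T → IsFinite (S ×ₛ T)
  ×-isFinite (m , f) (n , g) =
    m * n , Compose.inverse (Compose.inverse (f ×-inverse g) Pointwise-≡↔≡)
                            (Symmetry.inverse *↔×)

  ⇨-isFinite : IsFinite S → IsFinite T → IsFinite (FuncEq._⇨_ S T)
  ⇨-isFinite (m , f) (n , g) = n ^ m , record
    { to        = λ h → funToFin (λ i → g.to (to h (f.from i)))
    ; from      = λ c → record
      { to   = λ x → g.from (finToFun c (f.to x))
      ; cong = λ p → g.from-cong (≡.cong (finToFun c) (f.to-cong p))
      }
    ; to-cong   = λ p → funToFin-cong (λ i → g.to-cong (p (f.from i)))
    ; from-cong = λ { refl _ → Setoid.refl T }
    ; inverse   =
        (λ {c} p → ≡.trans
          (funToFin-cong (λ i → ≡.trans (g.inverseˡ (p (f.from i)))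
                                        (≡.cong (finToFun c) (f.strictlyInverseˡ i))))
          (funToFin-finToFin {m} c))
      , (λ { {h} refl x → g.inverseʳ (≡.trans
          (finToFun-funToFin (λ i → g.to (to h (f.from i))) (f.to x))
          (g.to-cong (cong h (f.strictlyInverseʳ x)))) })
    }
    where
      open Func using (to; cong)
      module f = Inverse f
      module g = Inverse g

      funToFin-cong : ∀ {m n} {h k : Fin m → Fin n} → (∀ i → h i ≡ k i) → funToFin h ≡ funToFin k
      funToFin-cong {zero}  p = refl
      funToFin-cong {suc m} p = ≡.cong₂ combine (p zero) (funToFin-cong (λ i → p (suc i)))

module _ (S : Setoid 0ℓ 0ℓ) where
  open Setoid S using (_≈_; sym; trans; reflexive)

  isFinite⇒decidable : IsFinite S → Decidable _≈_
  isFinite⇒decidable (n , f) x y =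
    map′ (λ p → trans (sym (f.strictlyInverseʳ x)) (f.inverseʳ p)) f.to-cong (f.to x ≟ᶠ f.to y)
    where module f = Inverse f

  isFinite⇒enumeration : IsFinite S → ∃ (IsEnumeration S)
  isFinite⇒enumeration (n , f) =
    map f.from (allFin n) ,
    λ x → Membership.∈-resp-≈ S (f.strictlyInverseʳ x)
            (Membership.∈-map⁺ (≡.setoid (Fin n)) S f.from-cong (∈-allFin (f.to x)))
    where module f = Inverse f

  enumeration⇒isFinite : Decidable _≈_ → ∃ (IsEnumeration S) → IsFinite S
  enumeration⇒isFinite _≈?_ (xs , enum) = length ys , record
    { to        = λ x → Any.index (enum′ x)
    ; from      = lookup ys
    ; to-cong   = λ {x} {y} p → lookup-injective unique _ _
                    (trans (trans (sym (lookup-index (enum′ x))) p) (lookup-index (enum′ y)))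
    ; from-cong = λ p → reflexive (≡.cong (lookup ys) p)
    ; inverse   =
        (λ {i} {x} p → lookup-injective unique _ _ (trans (sym (lookup-index (enum′ x))) p))
      , (λ { {x} refl → sym (lookup-index (enum′ x)) })
    }
    where
      S? : DecSetoid 0ℓ 0ℓ
      S? = record { isDecEquivalence = record { isEquivalence = Setoid.isEquivalence S ; _≟_ = _≈?_ } }

      ys : List (Carrier S)
      ys = deduplicate _≈?_ xs

      enum′ : IsEnumeration S ys
      enum′ = EnumerationP.deduplicate⁺ S? enum

      unique : Unique.Unique S ys
      unique = UniqueP.deduplicate-! S? xs

      All-lookup : ∀ {P : Carrier S → Set} {zs} → All P zs → ∀ i → P (lookup zs i)
      All-lookup (p ∷ ps) zero    = p
      All-lookup (p ∷ ps) (suc i) = All-lookup ps i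

      lookup-injective : ∀ {zs} → Unique.Unique S zs → ∀ i j → lookup zs i ≈ lookup zs j → i ≡ j
      lookup-injective (_ ∷ _) zero    zero    p = refl
      lookup-injective (q ∷ _) zero    (suc j) p = ⊥-elim (All-lookup q j p)
      lookup-injective (q ∷ _) (suc i) zero    p = ⊥-elim (All-lookup q i (sym p))
      lookup-injective (_ ∷ u) (suc i) (suc j) p = ≡.cong suc (lookup-injective u i j p)

-- Orbits H = ∑ₙ H[n] / 𝔖ₙ, where σ ∈ 𝔖ₙ acts on H[n] by H[σ].
module _ (H : Functor 𝔹 Sets) where
  private
    module H = Functor H
    open module H⟦n⟧ {n} = Setoid (H.F₀ ⟦ n ⟧)
      using (_≈_) renaming (sym to ≈-sym; trans to ≈-trans)

    act : ∀ {n} → Bij ⟦ n ⟧ ⟦ n ⟧ → Carrier (H.F₀ ⟦ n ⟧) → Carrier (H.F₀ ⟦ n ⟧)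
    act σ = Func.to (H.F₁ σ)

  data SameOrbit : Rel (Σ ℕ λ n → Carrier (H.F₀ ⟦ n ⟧)) 0ℓ where
    same : ∀ {n x y} (σ : Bij ⟦ n ⟧ ⟦ n ⟧) → act σ x ≈ y → SameOrbit (n , x) (n , y)

  private
    orbit-refl : ∀ {p} → SameOrbit p p
    orbit-refl {n , x} = same 𝔹.id (H.identity x)

    orbit-sym : ∀ {p q} → SameOrbit p q → SameOrbit q p
    orbit-sym (same {n} {x} {y} σ p) = same (σ ⁻¹)
      (≈-trans (Func.cong (H.F₁ (σ ⁻¹)) (≈-sym p))
      (≈-trans (≈-sym (H.homomorphism x))
      (≈-trans (H.F-resp-≈ (⁻¹-inverseˡ σ) x)
               (H.identity x))))

    orbit-trans : ∀ {p q r} → SameOrbit p q → SameOrbit q r → SameOrbit p r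
    orbit-trans (same {n} {x} σ p) (same τ q) =
      same (τ 𝔹.∘ σ) (≈-trans (H.homomorphism x) (≈-trans (Func.cong (H.F₁ τ) p) q))

  Orbits : Setoid 0ℓ 0ℓ
  Orbits = record
    { Carrier = Σ ℕ λ n → Carrier (H.F₀ ⟦ n ⟧)
    ; _≈_     = SameOrbit
    ; isEquivalence = record { refl = orbit-refl ; sym = orbit-sym ; trans = orbit-trans }
    }

  module _ (finite : ∀ n → IsFinite (H.F₀ ⟦ n ⟧)) where
    private
      sameOrbit? : ∀ {n} (x y : Carrier (H.F₀ ⟦ n ⟧)) → Dec (∃[ σ ] act σ x ≈ y)
      sameOrbit? {n} x y = map′ sound complete (any? λ i → any? λ j → witness? (finToFun i) (finToFun j))
        where
          Inv : (f g : Fin n → Fin n) → Set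
          Inv f g = StrictlyInverseˡ _≡_ f g × StrictlyInverseʳ _≡_ f g

          perm : ∀ f g → Inv f g → Bij ⟦ n ⟧ ⟦ n ⟧
          perm f g (p , q) = bij (mk↔ₛ′ f g p q)

          Witness : (f g : Fin n → Fin n) → Set
          Witness f g = Σ (Inv f g) λ inv → act (perm f g inv) x ≈ y

          witness? : ∀ f g → Dec (Witness f g)
          witness? f g with all? (λ i → f (g i) ≟ᶠ i) ×-dec all? (λ i → g (f i) ≟ᶠ i)
          ... | no ¬inv = no λ (inv , _) → ¬inv inv
          ... | yes inv = map′ (inv ,_)
                (λ (inv′ , p) → ≈-trans (H.F-resp-≈ {f = perm f g inv} {g = perm f g inv′} (λ _ → refl) x) p)
                (isFinite⇒decidable (H.F₀ ⟦ n ⟧) (finite n) (act (perm f g inv) x) y)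

          sound : (∃[ i ] ∃[ j ] Witness (finToFun i) (finToFun j)) → ∃[ σ ] act σ x ≈ y
          sound (i , j , inv , p) = perm _ _ inv , p

          complete : (∃[ σ ] act σ x ≈ y) → ∃[ i ] ∃[ j ] Witness (finToFun i) (finToFun j)
          complete (σ , p) = funToFin to , funToFin from , inv ,
            ≈-trans (H.F-resp-≈ {f = perm _ _ inv} {g = σ} (finToFun-funToFin to) x) p
            where
              open Bij σ using (to; from; strictlyInverseˡ; strictlyInverseʳ)
              to~   = finToFun-funToFin to
              from~ = finToFun-funToFin from
              inv : Inv (finToFun (funToFin to)) (finToFun (funToFin from))
              inv = (λ i → ≡.trans (to~ _) (≡.trans (≡.cong to (from~ i)) (strictlyInverseˡ i)))
                  , (λ i → ≡.trans (from~ _) (≡.trans (≡.cong from (to~ i)) (strictlyInverseʳ i)))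

      SameOrbit? : Decidable SameOrbit
      SameOrbit? (m , x) (n , y) with m ≟ n
      ... | no m≢n   = no λ { (same _ _) → m≢n refl }
      ... | yes refl = map′ (λ (σ , p) → same σ p) (λ { (same σ p) → σ , p }) (sameOrbit? x y)

    Orbits-isFinite : (∃[ N ] ∀ n → N ≤ n → ¬ Carrier (H.F₀ ⟦ n ⟧)) → IsFinite Orbits
    Orbits-isFinite (N , empty) = enumeration⇒isFinite Orbits SameOrbit?
      (concatMap level (upTo N) , enum)
      where
        elements = λ n → isFinite⇒enumeration (H.F₀ ⟦ n ⟧) (finite n)

        level : ℕ → List (Carrier Orbits)
        level n = map (n ,_) (proj₁ (elements n))

        enum : IsEnumeration Orbits (concatMap level (upTo N))
        enum (n , x) with n <? N
        ... | no n≮N  = ⊥-elim (empty n (≮⇒≥ n≮N) x)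
        ... | yes n<N = Membership.∈-concatMap⁺ (≡.setoid ℕ) Orbits
                (Any.map (λ { refl → Membership.∈-map⁺ (H.F₀ ⟦ n ⟧) Orbits
                               (λ p → same 𝔹.id (≈-trans (H.identity _) p))
                               (proj₂ (elements n) x) })
                         (∈-upTo⁺ n<N))

Orbits-map : ∀ {H K : Functor 𝔹 Sets} → NaturalTransformation H K → Func (Orbits H) (Orbits K)
Orbits-map {H} {K} α = record
  { to   = λ (n , x) → n , Func.to (η ⟦ n ⟧) x
  ; cong = λ { (same {n} {x} σ p) → same σ
      (Setoid.trans (Functor.F₀ K ⟦ n ⟧)
        (Setoid.sym (Functor.F₀ K ⟦ n ⟧) (commute σ x))
        (Func.cong (η ⟦ n ⟧) p)) }
  }
  where open NaturalTransformation α

≈⇒SameOrbit : ∀ (H : Functor 𝔹 Sets) {n x y} →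
              Setoid._≈_ (Functor.F₀ H ⟦ n ⟧) x y → SameOrbit H (n , x) (n , y)
≈⇒SameOrbit H {n} p = same 𝔹.id
  (Setoid.trans (Functor.F₀ H ⟦ n ⟧) (Functor.identity H _) p)

Species : Set₁
Species = Functor 𝔹 𝔹

Species₂ : Set₁
Species₂ = Functor (𝔹 ×C 𝔹) 𝔹

StrictlyFinite : Species → Set
StrictlyFinite F = ∃[ N ] ∀ n → N ≤ n → ¬ Carrier (set (Functor.F₀ F ⟦ n ⟧))

-- Transport along σ sends f : U → A to f ∘ σ⁻¹.
Power : Setoid 0ℓ 0ℓ → Functor 𝔹 Sets
Power A = record
  { F₀ = λ U → FuncEq._⇨_ (set U) A
  ; F₁ = λ σ → record
    { to   = λ f → f Sets.∘ Bij.func (σ ⁻¹)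
    ; cong = λ p x → p (Bij.from σ x)
    }
  ; identity     = λ f x → Setoid.refl A
  ; homomorphism = λ f x → Setoid.refl A
  ; F-resp-≈     = λ {_} {_} {σ} {τ} p f x → Func.cong f (⁻¹-cong {σ = σ} {τ} p x)
  }

infixr 8 _×F_
_×F_ : Functor 𝔹 Sets → Functor 𝔹 Sets → Functor 𝔹 Sets
H ×F K = record
  { F₀ = λ U → H.F₀ U ×ₛ K.F₀ U
  ; F₁ = λ σ → H.F₁ σ ×-function K.F₁ σ
  ; identity     = λ (x , y) → H.identity x , K.identity y
  ; homomorphism = λ (x , y) → H.homomorphism x , K.homomorphism y
  ; F-resp-≈     = λ p (x , y) → H.F-resp-≈ p x , K.F-resp-≈ p y
  }
  where
    module H = Functor H
    module K = Functor K

module _ (F : Species) where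
  private
    module F = Functor F

  terms : Setoid 0ℓ 0ℓ → Functor 𝔹 Sets
  terms A = (forget ∘F F) ×F Power A

  terms-map : ∀ {A B} → Func A B → NaturalTransformation (terms A) (terms B)
  terms-map {_} {B} g = record
    { η       = λ U → record
      { to   = λ (t , f) → t , (g Sets.∘ f)
      ; cong = λ (p , q) → p , λ x → Func.cong g (q x)
      }
    ; commute = λ {_} {V} σ (t , f) → Setoid.refl (set (F.F₀ V)) , λ x → Setoid.refl B
    }

  -- F(A) = ∑ₙ (F[n] × Aⁿ) / 𝔖ₙ for an arbitrary set A.
  analytic : Functor Sets Sets
  analytic = record
    { F₀ = λ A → Orbits (terms A)
    ; F₁ = λ g → Orbits-map (terms-map g)
    ; identity     = λ {A} (n , t , f) → ≈⇒SameOrbit (terms A)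
        (Setoid.refl (set (F.F₀ ⟦ n ⟧)) , λ x → Setoid.refl A)
    ; homomorphism = λ {_} {_} {C} (n , t , f) → ≈⇒SameOrbit (terms C)
        (Setoid.refl (set (F.F₀ ⟦ n ⟧)) , λ x → Setoid.refl C)
    ; F-resp-≈     = λ {_} {B} p (n , t , f) → ≈⇒SameOrbit (terms B)
        (Setoid.refl (set (F.F₀ ⟦ n ⟧)) , λ x → p (Func.to f x))
    }

  analytic-isFinite : StrictlyFinite F → ∀ {A} → IsFinite A → IsFinite (Functor.F₀ analytic A)
  analytic-isFinite (N , empty) {A} fin = Orbits-isFinite (terms A)
    (λ n → ×-isFinite (isFinite (F.F₀ ⟦ n ⟧)) (⇨-isFinite (isFinite ⟦ n ⟧) fin))
    (N , λ n N≤n (t , _) → empty n N≤n t)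

  -- The species F(G[·]).
  analyticComposite : StrictlyFinite F → Species → Species
  analyticComposite sf G = corestrict (analytic ∘F forget ∘F G)
    (λ V → analytic-isFinite sf (isFinite (Functor.F₀ G V)))

-- Ensures that ∑ₙ H[[n],V] / 𝔖ₙ is a finite set for every V.
StrictlyFiniteInX : Species₂ → Set₁
StrictlyFiniteInX H = ∀ V → ∃[ N ] ∀ n → N ≤ n → ¬ Carrier (set (Functor.F₀ H (⟦ n ⟧ , V)))

insertY : FinSet → Functor 𝔹 (𝔹 ×C 𝔹)
insertY V = record
  { F₀ = λ U → U , V
  ; F₁ = λ β → β , 𝔹.id
  ; identity     = λ {U} → (λ _ → Setoid.refl (set U)) , (λ _ → Setoid.refl (set V))
  ; homomorphism = λ {_} {_} {U} → (λ _ → Setoid.refl (set U)) , (λ _ → Setoid.refl (set V))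
  ; F-resp-≈     = λ p → p , (λ _ → Setoid.refl (set V))
  }

module _ (H : Species₂) where
  private
    module H = Functor H

  slice : FinSet → Functor 𝔹 Sets
  slice V = forget ∘F H ∘F insertY V

  slice-map : ∀ {V W} → Bij V W → NaturalTransformation (slice V) (slice W)
  slice-map {V} {W} σ = record
    { η       = λ U → Bij.func (H.F₁ (𝔹.id {U} , σ))
    ; commute = λ {U} {U′} β x →
        let open Setoid (set (H.F₀ (U′ , W))) using (sym; trans) in
        trans (sym (H.homomorphism {f = β , 𝔹.id} {g = 𝔹.id , σ} x))
        (trans (H.F-resp-≈ {f = (𝔹.id 𝔹.∘ β) , (σ 𝔹.∘ 𝔹.id)} {g = (β 𝔹.∘ 𝔹.id) , (𝔹.id 𝔹.∘ σ)}
                 ((λ _ → Setoid.refl (set U′)) , (λ _ → Setoid.refl (set W))) x)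
               (H.homomorphism {f = 𝔹.id , σ} {g = β , 𝔹.id} x))
    }

  -- H|_{X=1}[V] = ∑ₙ H[[n],V] / 𝔖ₙ.
  unlabelX : StrictlyFiniteInX H → Species
  unlabelX sf = corestrict
    (record
      { F₀ = λ V → Orbits (slice V)
      ; F₁ = λ σ → Orbits-map (slice-map σ)
      ; identity     = λ {V} (n , x) → ≈⇒SameOrbit (slice V) (H.identity x)
      ; homomorphism = λ {V} {W} {Z} {σ} {τ} (n , x) → ≈⇒SameOrbit (slice Z)
          (Setoid.trans (set (H.F₀ (⟦ n ⟧ , Z)))
            (H.F-resp-≈ {f = 𝔹.id , (τ 𝔹.∘ σ)} {g = (𝔹.id 𝔹.∘ 𝔹.id) , (τ 𝔹.∘ σ)}
              ((λ _ → refl) , (λ _ → Setoid.refl (set Z))) x)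
            (H.homomorphism {f = 𝔹.id , σ} {g = 𝔹.id , τ} x))
      ; F-resp-≈     = λ {V} {W} p (n , x) → ≈⇒SameOrbit (slice W)
          (H.F-resp-≈ ((λ _ → refl) , p) x)
      })
    (λ V → Orbits-isFinite (slice V) (λ n → isFinite (H.F₀ (⟦ n ⟧ , V))) (sf V))

-- F is regarded as a 2-sorted species with no points of sort Y, so it only sees
-- the first argument.
infixr 8 _×X_
_×X_ : Species → Species₂ → Species₂
F ×X K = record
  { F₀ = λ (U , V) → (set (F.F₀ U) ×ₛ set (K.F₀ (U , V)))
                   , ×-isFinite (isFinite (F.F₀ U)) (isFinite (K.F₀ (U , V)))
  ; F₁ = λ (β , σ) → bij (Bij.iso (F.F₁ β) ×-inverse Bij.iso (K.F₁ (β , σ)))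
  ; identity     = λ (x , y) → F.identity x , K.identity y
  ; homomorphism = λ (x , y) → F.homomorphism x , K.homomorphism y
  ; F-resp-≈     = λ (p , q) (x , y) → F.F-resp-≈ p x , K.F-resp-≈ (p , q) y
  }
  where
    module F = Functor F
    module K = Functor K

scalarProductX : (F : Species) → StrictlyFinite F → Species₂ → Species
scalarProductX F (N , empty) K =
  unlabelX (F ×X K) (λ V → N , λ n N≤n (t , _) → empty n N≤n t)

-- Φ(G)[U,V] is the set of all functions U → G[V]; transport along (β , σ)
-- sends f to G[σ] ∘ f ∘ β⁻¹.
Φ : Species → Species₂
Φ G = record
  { F₀ = λ (U , V) → FuncEq._⇨_ (set U) (set (G.F₀ V))
                   , ⇨-isFinite (isFinite U) (isFinite (G.F₀ V))
  ; F₁ = λ (β , σ) → transport β σ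
  ; identity     = λ f x → G.identity (Func.to f x)
  ; homomorphism = λ {_} {_} {_} {(β , σ)} {(γ , τ)} f x →
      G.homomorphism (Func.to f (Bij.from β (Bij.from γ x)))
  ; F-resp-≈     = λ {_} {(_ , V)} {(β , σ)} {(γ , τ)} (p , q) f x →
      Setoid.trans (set (G.F₀ V))
        (G.F-resp-≈ q (Func.to f (Bij.from β x)))
        (Bij.to-cong (G.F₁ τ) (Func.cong f (⁻¹-cong {σ = β} {γ} p x)))
  }
  where
    module G = Functor G

    transport : ∀ {U U′ V V′} → Bij U U′ → Bij V V′ →
                Bij (FuncEq._⇨_ (set U) (set (G.F₀ V)) , ⇨-isFinite (isFinite U) (isFinite (G.F₀ V)))
                    (FuncEq._⇨_ (set U′) (set (G.F₀ V′)) , ⇨-isFinite (isFinite U′) (isFinite (G.F₀ V′)))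
    transport {V = V} {V′} β σ = bij (record
      { to        = λ f → Bij.func Gσ Sets.∘ f Sets.∘ Bij.func (β ⁻¹)
      ; from      = λ f → Bij.func (Gσ ⁻¹) Sets.∘ f Sets.∘ Bij.func β
      ; to-cong   = λ p x → Bij.to-cong Gσ (p (Bij.from β x))
      ; from-cong = λ p x → Bij.from-cong Gσ (p (Bij.to β x))
      ; inverse   =
          (λ {f} p y → Bij.inverseˡ Gσ (Setoid.trans (set (G.F₀ V))
            (p (Bij.from β y))
            (Bij.from-cong Gσ (Func.cong f (Bij.strictlyInverseˡ β y)))))
        , (λ {f} p x → Bij.inverseʳ Gσ (Setoid.trans (set (G.F₀ V′))
            (p (Bij.to β x))
            (Bij.to-cong Gσ (Func.cong f (Bij.strictlyInverseʳ β x)))))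
      })
      where Gσ = G.F₁ σ

-- F ⊠ G; strict finiteness of F makes its values finite sets.
innerPlethysm : (F : Species) → StrictlyFinite F → Species → Species
innerPlethysm F sf G = scalarProductX F sf (Φ G)

{-# OPTIONS --safe #-}
-- Both functors send V to a quotient of ∑ₙ F[n] × G[V]ⁿ, and the isomorphism is
-- the identity on representatives.  The two actions of 𝔖ₙ agree up to G[id], and
-- the two transports along σ agree up to F[id], so functoriality identifies them.
module Submission where

open import Data.Product.Base using (_,_)
open import Function.Bundles using (Func; Inverse)
import Function.Construct.Identity as Identity
open import Relation.Binary.Bundles using (Setoid)
open import Defs

-- Every arrow of `𝔹` is invertible, and the inverses of the components of a natural family are
-- again natural.
𝔹-naturalIsomorphism : ∀ {o ℓ e} {C : Category o ℓ e} {S T : Functor C 𝔹} →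
                       NaturalTransformation S T → NaturalIsomorphism S T
𝔹-naturalIsomorphism {S = S} {T} α = record
  { F⇒G  = α
  ; F⇐G  = record
    { η       = λ V → η V ⁻¹
    ; commute = λ {V} {W} σ y →
        let open Setoid (set (T.F₀ W)) using (sym; trans) in
        -- Applying `η W` to both sides reduces the goal to naturality of `α` at the preimage of
        -- `y`.
        Bij.inverseʳ (η W) (sym
          (trans (commute σ (Bij.from (η V) y))
                 (Bij.to-cong (T.F₁ σ) (Bij.strictlyInverseˡ (η V) y))))
    }
  ; isoˡ = λ V → Bij.strictlyInverseʳ (η V)
  ; isoʳ = λ V → Bij.strictlyInverseˡ (η V)
  }
  where
    module T = Functor T
    open NaturalTransformation α

-- Naturality at permutations of `⟦ n ⟧` is equivariance, so both directions descend to orbits; they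
-- cancel there already on representatives.
Orbits-inverse : ∀ {H K : Functor 𝔹 Sets} → NaturalIsomorphism H K → Inverse (Orbits H) (Orbits K)
Orbits-inverse {H} {K} α = record
  { to        = to f
  ; from      = to g
  ; to-cong   = cong f
  ; from-cong = cong g
  ; inverse   =
      (λ { {n , x} p → Setoid.trans (Orbits K) (cong f p) (≈⇒SameOrbit K (isoʳ ⟦ n ⟧ x)) })
    , (λ { {n , x} p → Setoid.trans (Orbits H) (cong g p) (≈⇒SameOrbit H (isoˡ ⟦ n ⟧ x)) })
  }
  where
    open NaturalIsomorphism α
    open Func using (to; cong)
    f = Orbits-map F⇒G
    g = Orbits-map F⇐G

module _ (F G : Species) where
  private
    module F = Functor F
    module G = Functor G

  terms≅slice : ∀ V → NaturalIsomorphism (terms F (set (G.F₀ V))) (slice (F ×X Φ G) V)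
  terms≅slice V = record
    { F⇒G  = record
      { η       = λ _ → Identity.function _
      -- `slice` fixes `V` by transporting along `(β , id)`, hence the extra `G[id]` after
      -- `f ∘ β⁻¹`.
      ; commute = λ {_} {U} β (t , f) →
          Setoid.refl (set (F.F₀ U)) ,
          λ x → Setoid.sym (set (G.F₀ V)) (G.identity (Func.to f (Bij.from β x)))
      }
    ; F⇐G  = record
      { η       = λ _ → Identity.function _
      ; commute = λ {_} {U} β (t , f) →
          Setoid.refl (set (F.F₀ U)) , λ x → G.identity (Func.to f (Bij.from β x))
      }
    ; isoˡ = λ U x → Setoid.refl (Functor.F₀ (terms F (set (G.F₀ V))) U) {x}
    ; isoʳ = λ U x → Setoid.refl (Functor.F₀ (slice (F ×X Φ G) V) U) {x}
    }

lemma2p13 : (F G : Species) (sf : StrictlyFinite F) →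
    NaturalIsomorphism (analyticComposite F sf G) (innerPlethysm F sf G)
lemma2p13 F G sf = 𝔹-naturalIsomorphism (record
  { η       = λ V → bij (Orbits-inverse (terms≅slice F G V))
  -- The identity permutation suffices: the representatives differ only by the `F[id]` coming from
  -- `(id , σ)`, and both function parts compute to `G[σ] ∘ f`.
  ; commute = λ {_} {W} σ (n , t , f) → ≈⇒SameOrbit (slice (F ×X Φ G) W)
      ( Setoid.sym (set (F.F₀ ⟦ n ⟧)) (F.identity t)
      , λ _ → Setoid.refl (set (G.F₀ W)))
  })
  where
    module F = Functor F
    module G = Functor G
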